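{- In the unweighted online setting with $m$ identical machines, the Greedy-Balanced algorithm $\mathrm{ALG}$ (defined in the context) maintains EF1 at all times and has fair competitive ratio at most $2-\tfrac1m$; that is, for every input instance $\mathcal I$, $$|\mathrm{OPT}(\mathcal I)|\;\le\;\Bigl(2-\frac1m\Bigr)|\mathrm{ALG}(\mathcal I)| .$$
   Context: Setting. An instance $\mathcal I$ is a finite sequence of intervals $I_1,\dots,I_n$, each of weight $1$. Interval $I_j$ has start time $s_j$ and end time $e_j$, $s_j<e_j$, both nonnegative rationals, and is identified with $[s_j,e_j)$. Two intervals overlap (conflict) if these sets intersect. Machines are $\mathcal A=\{1,\dots,m\}$. A schedule assigns a subset of the intervals to machines, each to exactly one machine, with no two intervals on the same machine overlapping. $\mathrm{OPT}(\mathcal I)$ is a schedule with the maximum number $|\mathrm{OPT}(\mathcal I)|$ of assigned intervals, without fairness requirement and with the whole instance known. Online model. Intervals arrive one at a time in index order, with $s_1\le s_2\le\dots\le s_n$. When $I_j$ arrives (at time $s_j$) the algorithm learns $(s_j,e_j)$ and must immediately reject it (irrevocably) or accept it and assign it to a machine, without knowledge of later intervals. An accepted interval may be revoked (removed from the schedule) at any time before its end time; a revoked interval can never be scheduled again. $S_i$ denotes the set of intervals currently assigned to machine $i$ (accepted and not revoked so far, including already completed ones), and $C_i=|S_i|$ is its load. $\mathrm{ALG}(\mathcal I)$ is the final schedule, i.e. the set of intervals accepted and never revoked. EF1: for all machines $i\neq k$ with $S_k\ne\emptyset$ there is $I\in S_k$ with $|S_i|\ge|S_k\setminus\{I\}|$;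 equivalently any two loads differ by at most one. The fair competitive ratio of an online EF1 algorithm is the smallest $\alpha$ with $|\mathrm{OPT}(\mathcal I)|\le\alpha|\mathrm{ALG}(\mathcal I)|$ for all instances $\mathcal I$. Greedy-Optimal algorithm $\mathcal E$ (no fairness). The leader of a machine is the rightmost interval currently assigned to it. When $I_i=[s_i,e_i)$ arrives: if it can be assigned to some machine without conflict, accept it on such a machine. Otherwise the leader of every machine overlaps $I_i$; if $e_i$ is smaller than the largest end time among the leaders, revoke a leader with largest end time and assign $I_i$ to that machine; else reject $I_i$. Greedy-Balanced algorithm. It runs $\mathcal E$ in parallel on the same input. When $I_i=[s_i,e_i)$ arrives: 1. (Filter) If $\mathcal E$ rejects $I_i$, reject $I_i$. If $\mathcal E$ revokes an interval $J$ to accept $I_i$ and Greedy-Balanced currently has $J$ scheduled on some machine, then it also revokes $J$ and schedules $I_i$ on that same machine. Otherwise go to step 2. 2. (EF1-preserving placement) Let $\mathcal F_i\subseteq\mathcal A$ be the set of machines on which $I_i$ can be scheduled without conflict. If $\mathcal F_i\ne\emptyset$, choose $f\in\arg\min_{\ell\in\mathcal F_i}C_\ell$ (ties broken arbitrarily); if assigning $I_i$ to $f$ preserves EF1, assign $I_i$ to $f$ and finish with this arrival. 3. (Repair) Otherwise (no machine of $\mathcal F_i$ can receive $I_i$ without violating EF1, including the case $\mathcal F_i=\emptyset$), let $L_i=\{k\in\mathcal A: C_k=\min_{\ell\in\mathcal A}C_\ell\}$. If there are $k\in L_i$ and $J\in S_k$ such that $J$ overlaps $I_i$ and $e_J>e_i$,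 where $e_J$ is the end time of $J$, choose such a pair $(k,J)$ with maximum $e_J$, revoke $J$, and assign $I_i$ to machine $k$ in its place. 4. Otherwise reject $I_i$. -}

module Defs where

open import Data.Fin.Base as Fin using (Fin; toℕ)
open import Data.Fin.Properties using () renaming (_≟_ to _≟ᶠ_)
open import Data.Fin.Subset using (Subset; _∈_; _∉_; _-_; ∣_∣; Nonempty)
open import Data.Maybe.Base using (Maybe; just; nothing; is-just)
open import Data.Maybe.Properties using (≡-dec)
open import Data.Nat.Base as ℕ using (ℕ; suc)
open import Data.Product.Base using (∃; _×_)
open import Data.Rational.Base using (ℚ; 0ℚ; _≤_; _<_)
open import Data.Vec.Base using (Vec; map; replicate; _[_]≔_)
open import Relation.Binary.PropositionalEquality using (_≢_)
open import Relation.Nullary using (¬_; does)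

record Interval : Set where
  field
    start       : ℚ
    end         : ℚ
    0≤start     : 0ℚ ≤ start
    start<end   : start < end

open Interval public

-- Half-open: I is the set [ start I , end I ).
infix 4 _∈ᴵ_

_∈ᴵ_ : ℚ → Interval → Set
x ∈ᴵ I = start I ≤ x × x < end I

Overlap : Interval → Interval → Set
Overlap I J = ∃ λ x → x ∈ᴵ I × x ∈ᴵ J

record Instance : Set where
  field
    size     : ℕ
    interval : Fin size → Interval
    sorted   : ∀ {i j} → i Fin.≤ j → start (interval i) ≤ start (interval j)

open Instance public

-- Entry j is the machine holding interval j, or nothing if j is not (or no
-- longer) scheduled.
Assignment : ℕ → ℕ → Set
Assignment m n = Vec (Maybe (Fin m)) n

module _ {m n : ℕ} where

  S : Assignment m n → Fin m → Subset n
  S σ k = map (λ x → does (≡-dec _≟ᶠ_ x (just k))) σ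

  C : Assignment m n → Fin m → ℕ
  C σ k = ∣ S σ k ∣

  scheduled : Assignment m n → Subset n
  scheduled σ = map is-just σ

  EF1 : Assignment m n → Set
  EF1 σ = ∀ i k → i ≢ k → Nonempty (S σ k) →
          ∃ λ I → I ∈ S σ k × ∣ S σ i ∣ ℕ.≥ ∣ S σ k - I ∣

-- What an algorithm does with an arriving interval.  `replace J k` revokes J
-- and assigns the arriving interval to machine k (which held J).
data Action (m n : ℕ) : Set where
  reject  : Action m n
  assign  : Fin m → Action m n
  replace : Fin n → Fin m → Action m n

apply : ∀ {m n} → Fin n → Action m n → Assignment m n → Assignment m n
apply i reject        σ = σ
apply i (assign k)    σ = σ [ i ]≔ just k
apply i (replace J k) σ = (σ [ J ]≔ nothing) [ i ]≔ just k

module _ {m : ℕ} (𝓘 : Instance) where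

  private
    Job = Fin (size 𝓘)
    Asg = Assignment m (size 𝓘)
    Act = Action m (size 𝓘)

    e : Job → ℚ
    e j = end (interval 𝓘 j)

    Conflict : Job → Job → Set
    Conflict i j = Overlap (interval 𝓘 i) (interval 𝓘 j)

  IsSchedule : Asg → Set
  IsSchedule σ = ∀ k {i j} → i ∈ S σ k → j ∈ S σ k → i ≢ j → ¬ Conflict i j

  IsOptimal : Asg → Set
  IsOptimal σ = IsSchedule σ ×
    (∀ τ → IsSchedule τ → ∣ scheduled τ ∣ ℕ.≤ ∣ scheduled σ ∣)

  Fits : Asg → Job → Fin m → Set
  Fits σ i k = ∀ {J} → J ∈ S σ k → ¬ Conflict J i

  -- The intervals on one machine are disjoint, so "rightmost" may be read off
  -- the end times.
  Leader : Asg → Fin m → Job → Set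
  Leader σ k J = J ∈ S σ k × (∀ {J′} → J′ ∈ S σ k → e J′ ≤ e J)

  LargestLeader : Asg → Fin m → Job → Set
  LargestLeader σ k J = Leader σ k J ×
    (∀ {k′ J′} → Leader σ k′ J′ → e J′ ≤ e J)

  -- Admissible actions of the Greedy-Optimal algorithm with current assignment
  -- ε on the arrival of i.  Ties make this a relation rather than a function.
  data GreedyOptimal (ε : Asg) (i : Job) : Act → Set where
    accept : ∀ {k} → Fits ε i k → GreedyOptimal ε i (assign k)
    revoke : ∀ {k J} → (∀ k′ → ¬ Fits ε i k′) →
             LargestLeader ε k J → e i < e J →
             GreedyOptimal ε i (replace J k)
    reject : (∀ k → ¬ Fits ε i k) →
             (∀ {k J} → LargestLeader ε k J → ¬ (e i < e J)) →
             GreedyOptimal ε i reject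

  -- The action of Greedy-Optimal sends the arriving interval past the filter.
  data Passes (σ : Asg) : Act → Set where
    accepted : ∀ {k} → Passes σ (assign k)
    revoked  : ∀ {J k} → (∀ k′ → J ∉ S σ k′) → Passes σ (replace J k)

  Placement : Asg → Job → Fin m → Set
  Placement σ i f =
    Fits σ i f × (∀ ℓ → Fits σ i ℓ → C σ f ℕ.≤ C σ ℓ) ×
    EF1 (apply i (assign f) σ)

  RepairCandidate : Asg → Job → Fin m → Job → Set
  RepairCandidate σ i k J =
    (∀ ℓ → C σ k ℕ.≤ C σ ℓ) × J ∈ S σ k × Conflict J i × e i < e J

  -- Admissible actions (last index) of Greedy-Balanced with current assignment
  -- σ on the arrival of i, given the action of Greedy-Optimal (first index).
  data GreedyBalanced (σ : Asg) (i : Job) : Act → Act → Set where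
    filter-reject : GreedyBalanced σ i reject reject
    filter-revoke : ∀ {J k k′} → J ∈ S σ k →
                    GreedyBalanced σ i (replace J k′) (replace J k)
    place         : ∀ {a f} → Passes σ a → Placement σ i f →
                    GreedyBalanced σ i a (assign f)
    repair        : ∀ {a k J} → Passes σ a → (∀ f → ¬ Placement σ i f) →
                    RepairCandidate σ i k J →
                    (∀ {k′ J′} → RepairCandidate σ i k′ J′ → e J′ ≤ e J) →
                    GreedyBalanced σ i a (replace J k)
    reject        : ∀ {a} → Passes σ a → (∀ f → ¬ Placement σ i f) →
                    (∀ k J → ¬ RepairCandidate σ i k J) →
                    GreedyBalanced σ i a reject

  -- Run t ε σ: for some tie-breaking, after the first t arrivals the parallel
  -- execution of Greedy-Optimal holds ε and Greedy-Balanced holds σ.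
  data Run : ℕ → Asg → Asg → Set where
    initially : Run 0 (replicate _ nothing) (replicate _ nothing)
    arrival   : ∀ {ε σ a b} (i : Job) → Run (toℕ i) ε σ →
                GreedyOptimal ε i a → GreedyBalanced σ i a b →
                Run (suc (toℕ i)) (apply i a ε) (apply i b σ)

{-# OPTIONS --safe #-}
module Submission where

-- Greedy-Optimal is optimal by exchange: a set of depth at most m that agrees
-- with it on all arrived intervals survives each arrival after trading one
-- interval for one ending no later.
--
-- Greedy-Balanced holds a subset of the intervals of Greedy-Optimal; call the
-- others lost, and let L be the minimum load.  An interval is only lost when every
-- machine of load L is busy, and then it ends no earlier than anything on
-- those machines.  Until the minimum load
-- rises, later changes on machines of load L only decrease end times.  So at
-- any further loss all intervals lost at this level are active together with
-- one that is not lost, and Greedy-Optimal has at most m active intervals: at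
-- most m - 1 are lost per level.  Nothing is lost at level 0, as then a machine
-- of minimum load is idle, hence at most (m - 1) L are lost altogether, while
-- Greedy-Balanced holds at least m L.

open import Defs
open import Data.Empty using (⊥; ⊥-elim; ⊥-elim-irr)
open import Data.Fin.Base as Fin using (Fin; zero; suc; toℕ)
open import Data.Fin.Properties as Fin using (any?)
open import Data.Fin.Subset
  using (Subset; ∣_∣; Empty; _∈_; _∉_; _⊆_; _∩_; _─_; ⁅_⁆; inside; outside)
open import Data.Fin.Subset.Properties
open import Data.Integer.Base as ℤ using (+_)
import Data.Integer.Properties as ℤ
import Data.List.Base as List
open import Data.List.Extrema.Nat using ()
  renaming (argmin to argminℕ; f[argmin]≤f[xs] to argminℕ-≤)
import Data.List.Extrema as Extrema
open import Data.List.Membership.Propositional.Properties using (∈-allFin; ∈-filter⁺)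
import Data.List.Relation.Unary.All as All
open import Data.List.Relation.Unary.All.Properties using (all-filter)
open import Data.Maybe.Base using (just; nothing; is-just)
open import Data.Maybe.Properties using (≡-dec; just-injective)
open import Data.Nat.Base as ℕ using (ℕ; zero; suc; pred; NonZero; z≤n; s≤s)
import Data.Nat.Properties as ℕ
open import Data.Nat.Solver using (module +-*-Solver)
open import Data.Product.Base using (∃; _×_; _,_; proj₁; proj₂)
open import Data.Rational.Base as ℚ using (ℚ; toℚᵘ; _/_; _≤_; _<_; _*_; _-_)
import Data.Rational.Properties as ℚ
open import Data.Rational.Unnormalised.Base as ℚᵘ using (mkℚᵘ; *≤*)
import Data.Rational.Unnormalised.Properties as ℚᵘ
open import Data.Sum.Base using (_⊎_; inj₁; inj₂)
open import Data.Vec.Base using (lookup; tabulate; []; _∷_; replicate; _[_]=_; _[_]≔_)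
open import Data.Vec.Properties
  using (lookup-map; lookup∘update; lookup∘update′; lookup∘tabulate; lookup-replicate;
         []=⇒lookup; lookup⇒[]=; map-[]≔; []≔-lookup; []≔-idempotent)
open import Function.Base using (_∘_)
open import Relation.Binary.Bundles using (DecTotalOrder)
open import Relation.Binary.PropositionalEquality
  using (_≡_; _≢_; refl; sym; trans; cong; cong₂; subst; subst₂)
open import Relation.Nullary using (¬_; Dec; does; yes; no; contradiction; ¬?; _×-dec_)
open import Relation.Nullary.Decidable using (dec-true)
open import Relation.Unary using (Decidable)

-- Finite sets

module _ {n : ℕ} where

  subset : ∀ {P : Fin n → Set} → Decidable P → Subset n
  subset P? = tabulate (does ∘ P?)

  ∈-subset⁺ : ∀ {P : Fin n → Set} (P? : Decidable P) {j} → P j → j ∈ subset P?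
  ∈-subset⁺ P? {j} Pj =
    lookup⇒[]= j _ (trans (lookup∘tabulate (does ∘ P?) j) (dec-true (P? j) Pj))

  ∈-subset⁻ : ∀ {P : Fin n → Set} (P? : Decidable P) {j} → j ∈ subset P? → P j
  ∈-subset⁻ P? {j} j∈
    with P? j | trans (sym (lookup∘tabulate (does ∘ P?) j)) ([]=⇒lookup j∈)
  ... | yes Pj | _ = Pj
  ... | no _   | ()

∣p∣≡∣p∩q∣+∣p─q∣ : ∀ {n} (p q : Subset n) → ∣ p ∣ ≡ ∣ p ∩ q ∣ ℕ.+ ∣ p ─ q ∣
∣p∣≡∣p∩q∣+∣p─q∣ []            []            = refl
∣p∣≡∣p∩q∣+∣p─q∣ (inside  ∷ p) (inside  ∷ q) = cong suc (∣p∣≡∣p∩q∣+∣p─q∣ p q)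
∣p∣≡∣p∩q∣+∣p─q∣ (inside  ∷ p) (outside ∷ q) =
  trans (cong suc (∣p∣≡∣p∩q∣+∣p─q∣ p q)) (sym (ℕ.+-suc _ _))
∣p∣≡∣p∩q∣+∣p─q∣ (outside ∷ p) (inside  ∷ q) = ∣p∣≡∣p∩q∣+∣p─q∣ p q
∣p∣≡∣p∩q∣+∣p─q∣ (outside ∷ p) (outside ∷ q) = ∣p∣≡∣p∩q∣+∣p─q∣ p q

x∈p─q⇒x∉q : ∀ {n} {x : Fin n} (p q : Subset n) → x ∈ p ─ q → x ∉ q
x∈p─q⇒x∉q {x = zero}  (_ ∷ p) (inside  ∷ q) ()
x∈p─q⇒x∉q {x = zero}  (_ ∷ p) (outside ∷ q) _ ()
x∈p─q⇒x∉q {x = suc x} (_ ∷ p) (inside  ∷ q) x∈ x∈q = x∈p─q⇒x∉q p q (drop-there x∈) (drop-there x∈q)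
x∈p─q⇒x∉q {x = suc x} (_ ∷ p) (outside ∷ q) x∈ x∈q = x∈p─q⇒x∉q p q (drop-there x∈) (drop-there x∈q)

x∈p⇒∣p∣≡1+∣p-x∣ : ∀ {n} {x : Fin n} {p : Subset n} → x ∈ p → ∣ p ∣ ≡ suc ∣ p ─ ⁅ x ⁆ ∣
x∈p⇒∣p∣≡1+∣p-x∣ {x = x} {p} x∈p = ℕ.≤-antisym upper (x∈p⇒∣p-x∣<∣p∣ x∈p)
  where
  upper : ∣ p ∣ ℕ.≤ suc ∣ p ─ ⁅ x ⁆ ∣
  upper = begin
    ∣ p ∣                          ≡⟨ ∣p∣≡∣p∩q∣+∣p─q∣ p ⁅ x ⁆ ⟩
    ∣ p ∩ ⁅ x ⁆ ∣ ℕ.+ ∣ p ─ ⁅ x ⁆ ∣    ≤⟨ ℕ.+-monoˡ-≤ _ (∣p∩q∣≤∣q∣ p ⁅ x ⁆) ⟩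
    ∣ ⁅ x ⁆ ∣ ℕ.+ ∣ p ─ ⁅ x ⁆ ∣        ≡⟨ cong (ℕ._+ ∣ p ─ ⁅ x ⁆ ∣) (∣⁅x⁆∣≡1 x) ⟩
    suc ∣ p ─ ⁅ x ⁆ ∣                  ∎
    where open ℕ.≤-Reasoning

∣insert∣ : ∀ {n} (p : Subset n) (i : Fin n) → i ∉ p → ∣ p [ i ]≔ inside ∣ ≡ suc ∣ p ∣
∣insert∣ (inside  ∷ p) zero    i∉p = contradiction _[_]=_.here i∉p
∣insert∣ (outside ∷ p) zero    i∉p = refl
∣insert∣ (inside  ∷ p) (suc i) i∉p = cong suc (∣insert∣ p i (drop-not-there i∉p))
∣insert∣ (outside ∷ p) (suc i) i∉p = ∣insert∣ p i (drop-not-there i∉p)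

∈-insert : ∀ {n} (p : Subset n) (i : Fin n) → i ∈ p [ i ]≔ inside
∈-insert p i = lookup⇒[]= i _ (lookup∘update i p inside)

∈-update⁻ : ∀ {n} {p : Subset n} {i j} {s} → j ≢ i → j ∈ p [ i ]≔ s → j ∈ p
∈-update⁻ {p = p} {j = j} {s} j≢i j∈ =
  lookup⇒[]= j p (trans (sym (lookup∘update′ j≢i p s)) ([]=⇒lookup j∈))

∈-update⁺ : ∀ {n} {p : Subset n} {i j} {s} → j ≢ i → j ∈ p → j ∈ p [ i ]≔ s
∈-update⁺ {p = p} {j = j} {s} j≢i j∈ =
  lookup⇒[]= j _ (trans (lookup∘update′ j≢i p s) ([]=⇒lookup j∈))

∉-delete : ∀ {n} (p : Subset n) (i : Fin n) → i ∉ p [ i ]≔ outside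
∉-delete p i i∈ with trans (sym (lookup∘update i p outside)) ([]=⇒lookup i∈)
... | ()

∣delete∣ : ∀ {n} (p : Subset n) (i : Fin n) → i ∈ p → ∣ p ∣ ≡ suc ∣ p [ i ]≔ outside ∣
∣delete∣ p i i∈p = trans (cong ∣_∣ restore) (∣insert∣ (p [ i ]≔ outside) i (∉-delete p i))
  where
  restore : p ≡ (p [ i ]≔ outside) [ i ]≔ inside
  restore = trans (sym ([]≔-lookup p i))
    (trans (cong (p [ i ]≔_) ([]=⇒lookup i∈p)) (sym ([]≔-idempotent p i)))

swap : ∀ {n} → Subset n → Fin n → Fin n → Subset n
swap p a b = (p [ a ]≔ outside) [ b ]≔ inside

∣swap∣ : ∀ {n} {p : Subset n} {a b} → a ∈ p → b ∉ p → ∣ swap p a b ∣ ≡ ∣ p ∣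
∣swap∣ {p = p} {a} {b} a∈p b∉p =
  trans (∣insert∣ (p [ a ]≔ outside) b (b∉p ∘ ∈-update⁻ b≢a)) (sym (∣delete∣ p a a∈p))
  where
  b≢a : b ≢ a
  b≢a refl = b∉p a∈p

∈-swap⁻ : ∀ {n} {p : Subset n} {a b j} → j ∈ swap p a b → j ≡ b ⊎ (j ≢ a × j ∈ p)
∈-swap⁻ {p = p} {a} {b} {j} j∈ with j Fin.≟ b | j Fin.≟ a
... | yes j≡b | _        = inj₁ j≡b
... | no j≢b  | yes refl = contradiction (∈-update⁻ j≢b j∈) (∉-delete p a)
... | no j≢b  | no j≢a   = inj₂ (j≢a , ∈-update⁻ j≢a (∈-update⁻ j≢b j∈))

empty⇒∣p∣≡0 : ∀ {n} {p : Subset n} → Empty p → ∣ p ∣ ≡ 0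
empty⇒∣p∣≡0 {n} empty = trans (cong ∣_∣ (Empty-unique empty)) (∣⊥∣≡0 n)

subsingleton⇒∣p∣≤1 : ∀ {n} (p : Subset n) → (∀ {x y} → x ∈ p → y ∈ p → x ≡ y) → ∣ p ∣ ℕ.≤ 1
subsingleton⇒∣p∣≤1 p unique with nonempty? p
... | no empty = ℕ.≤-trans (ℕ.≤-reflexive (empty⇒∣p∣≡0 empty)) z≤n
... | yes (x , x∈p) = subst (∣ p ∣ ℕ.≤_) (∣⁅x⁆∣≡1 x)
  (p⊆q⇒∣p∣≤∣q∣ (λ {y} y∈p → subst (_∈ ⁅ x ⁆) (unique x∈p y∈p) (x∈⁅x⁆ x)))

-- Peeling off one `U k` at a time removes at most `c` elements each. The use is with `c = 1`, where
-- `U k` is the part of machine `k` that is active at a point.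
∣cover∣≤ : ∀ {m n c} (U : Fin m → Subset n) (T : Subset n) →
           (∀ {x} → x ∈ T → ∃ λ k → x ∈ U k) → (∀ k → ∣ U k ∣ ℕ.≤ c) →
           ∣ T ∣ ℕ.≤ m ℕ.* c
∣cover∣≤ {zero} U T covers small with nonempty? T
... | yes (x , x∈T) with covers x∈T
... | () , _
∣cover∣≤ {zero} U T covers small | no empty = ℕ.≤-reflexive (empty⇒∣p∣≡0 empty)
∣cover∣≤ {suc m} {c = c} U T covers small = begin
  ∣ T ∣                                ≡⟨ ∣p∣≡∣p∩q∣+∣p─q∣ T (U zero) ⟩
  ∣ T ∩ U zero ∣ ℕ.+ ∣ T ─ U zero ∣    ≤⟨ ℕ.+-mono-≤ (ℕ.≤-trans (∣p∩q∣≤∣q∣ T _) (small zero))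
                                            (∣cover∣≤ (U ∘ suc) _ covers′ (small ∘ suc)) ⟩
  c ℕ.+ m ℕ.* c                        ∎
  where
  open ℕ.≤-Reasoning
  covers′ : ∀ {x} → x ∈ T ─ U zero → ∃ λ k → x ∈ U (suc k)
  covers′ x∈ with covers (p─q⊆p T _ x∈)
  ... | zero  , x∈U = contradiction x∈U (x∈p─q⇒x∉q T _ x∈)
  ... | suc k , x∈U = k , x∈U

-- Disjointness keeps the remaining `U k` inside `T ─ U zero`, so the induction goes through. It
-- serves with `c = 1` to count blocked machines and with `c` a common lower bound on the loads to
-- bound the number of scheduled intervals.
≤∣packing∣ : ∀ {m n c} (U : Fin m → Subset n) (T : Subset n) →
             (∀ k → U k ⊆ T) → (∀ {x k k′} → x ∈ U k → x ∈ U k′ → k ≡ k′) →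
             (∀ k → c ℕ.≤ ∣ U k ∣) → m ℕ.* c ℕ.≤ ∣ T ∣
≤∣packing∣ {zero} U T within disjoint large = z≤n
≤∣packing∣ {suc m} {c = c} U T within disjoint large = begin
  c ℕ.+ m ℕ.* c                        ≤⟨ ℕ.+-mono-≤ (ℕ.≤-trans (large zero) (p⊆q⇒∣p∣≤∣q∣ first))
                                            (≤∣packing∣ (U ∘ suc) _ rest disjoint′ (large ∘ suc)) ⟩
  ∣ T ∩ U zero ∣ ℕ.+ ∣ T ─ U zero ∣    ≡⟨ sym (∣p∣≡∣p∩q∣+∣p─q∣ T (U zero)) ⟩
  ∣ T ∣                                ∎
  where
  open ℕ.≤-Reasoning
  first : U zero ⊆ T ∩ U zero
  first x∈ = x∈p∩q⁺ (within zero x∈ , x∈)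
  rest : ∀ k → U (suc k) ⊆ T ─ U zero
  rest k x∈ = x∈p∧x∉q⇒x∈p─q (within (suc k) x∈) (λ x∈₀ → contradiction (disjoint x∈₀ x∈) λ ())
  disjoint′ : ∀ {x k k′} → x ∈ U (suc k) → x ∈ U (suc k′) → k ≡ k′
  disjoint′ x∈ x∈′ = Fin.suc-injective (disjoint x∈ x∈′)

-- Unfolding argmin in with-abstractions is prohibitively expensive.
abstract

  ∃argmin : ∀ {p} (f : Fin (suc p) → ℕ) → ∃ λ k → ∀ ℓ → f k ℕ.≤ f ℓ
  ∃argmin {p} f = argminℕ f zero (List.allFin (suc p)) ,
    λ ℓ → All.lookup (argminℕ-≤ {f = f} zero (List.allFin (suc p))) (∈-allFin ℓ)

∃argmax : ∀ {n} (f : Fin n → ℚ) (p : Subset n) {x} → x ∈ p →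
          ∃ λ y → y ∈ p × (∀ {z} → z ∈ p → f z ≤ f y)
∃argmax f p {x} x∈p = argmax f x xs , argmax-all f {P = _∈ p} x∈p (all-filter (_∈? p) (List.allFin _)) ,
  λ z∈p → All.lookup (f[xs]≤f[argmax] {f = f} x xs) (∈-filter⁺ (_∈? p) (∈-allFin _) z∈p)
  where
  open Extrema (DecTotalOrder.totalOrder ℚ.≤-decTotalOrder)
  xs = List.filter (_∈? p) (List.allFin _)

-- Assignments

module _ {m n : ℕ} where

  Revokes : Action m n → Fin n → Set
  Revokes reject        j = ⊥
  Revokes (assign _)    j = ⊥
  Revokes (replace J _) j = j ≡ J

  Schedules : Action m n → Fin m → Set
  Schedules reject        k = ⊥
  Schedules (assign f)    k = k ≡ f
  Schedules (replace _ f) k = k ≡ f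

  module _ {σ : Assignment m n} where

    ∈S⁺ : ∀ {j k} → lookup σ j ≡ just k → j ∈ S σ k
    ∈S⁺ {j} {k} eq = lookup⇒[]= j _
      (trans (lookup-map j _ σ) (dec-true (≡-dec Fin._≟_ (lookup σ j) (just k)) eq))

    ∈S⁻ : ∀ {j k} → j ∈ S σ k → lookup σ j ≡ just k
    ∈S⁻ {j} {k} j∈
      with ≡-dec Fin._≟_ (lookup σ j) (just k) | trans (sym (lookup-map j _ σ)) ([]=⇒lookup j∈)
    ... | yes eq | _ = eq
    ... | no _   | ()

    S-disjoint : ∀ {j k k′} → j ∈ S σ k → j ∈ S σ k′ → k ≡ k′
    S-disjoint j∈ j∈′ = just-injective (trans (sym (∈S⁻ j∈)) (∈S⁻ j∈′))

    S⊆scheduled : ∀ k → S σ k ⊆ scheduled σ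
    S⊆scheduled k {j} j∈ =
      lookup⇒[]= j _ (trans (lookup-map j is-just σ) (cong is-just (∈S⁻ j∈)))

    scheduled⇒S : ∀ {j} → j ∈ scheduled σ → ∃ λ k → j ∈ S σ k
    scheduled⇒S {j} j∈
      with lookup σ j in eq | trans (sym (lookup-map j is-just σ)) ([]=⇒lookup j∈)
    ... | just k | _ = k , ∈S⁺ eq

  lookup-apply : ∀ (σ : Assignment m n) {i j} a → j ≢ i → ¬ Revokes a j →
                 lookup (apply i a σ) j ≡ lookup σ j
  lookup-apply σ reject        j≢i kept = refl
  lookup-apply σ (assign k)    j≢i kept = lookup∘update′ j≢i σ _
  lookup-apply σ (replace J k) j≢i kept =
    trans (lookup∘update′ j≢i (σ [ J ]≔ nothing) _) (lookup∘update′ kept σ _)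

  kept⇒S : ∀ {σ : Assignment m n} {i j k} a → j ≢ i → ¬ Revokes a j →
           j ∈ S σ k → j ∈ S (apply i a σ) k
  kept⇒S {σ} {i} a j≢i kept j∈ = ∈S⁺ {σ = apply i a σ} (trans (lookup-apply σ a j≢i kept) (∈S⁻ j∈))

  S⇒kept : ∀ {σ : Assignment m n} {i j k} a → j ≢ i →
           j ∈ S (apply i a σ) k → ¬ Revokes a j × j ∈ S σ k
  S⇒kept {σ} {i} {j} a j≢i j∈ =
    kept a j∈ , ∈S⁺ {σ = σ} (trans (sym (lookup-apply σ a j≢i (kept a j∈))) (∈S⁻ j∈))
    where
    kept : ∀ a {k} → j ∈ S (apply i a σ) k → ¬ Revokes a j
    kept (replace J _) j∈ refl
      with trans (sym (trans (lookup∘update′ j≢i (σ [ j ]≔ nothing) _) (lookup∘update j σ nothing))) (∈S⁻ j∈)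
    ... | ()

  new∈S : ∀ {σ : Assignment m n} {i k} a → Schedules a k → i ∈ S (apply i a σ) k
  new∈S {σ} {i} (assign f)    refl = ∈S⁺ (lookup∘update i σ _)
  new∈S {σ} {i} (replace J f) refl = ∈S⁺ (lookup∘update i (σ [ J ]≔ nothing) _)

  S-assign : ∀ (σ : Assignment m n) i f k →
             S (apply i (assign f) σ) k ≡ S σ k [ i ]≔ does (≡-dec Fin._≟_ (just f) (just k))
  S-assign σ i f k = map-[]≔ _ σ i

  C-assign-≡ : ∀ {σ : Assignment m n} {i} f → i ∉ S σ f →
               C (apply i (assign f) σ) f ≡ suc (C σ f)
  C-assign-≡ {σ} {i} f i∉ = trans
    (cong ∣_∣ (trans (S-assign σ i f f)
      (cong (S σ f [ i ]≔_) (dec-true (≡-dec Fin._≟_ (just f) (just f)) refl))))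
    (∣insert∣ (S σ f) i i∉)

  C-assign-≥ : ∀ {σ : Assignment m n} {i} f k → (∀ k → i ∉ S σ k) →
               C σ k ℕ.≤ C (apply i (assign f) σ) k
  C-assign-≥ {σ} {i} f k i∉ = p⊆q⇒∣p∣≤∣q∣ {p = S σ k} {S (apply i (assign f) σ) k}
    (λ j∈ → kept⇒S (assign f) (λ {refl → i∉ k j∈}) (λ ()) j∈)

  C-assign-≢ : ∀ {σ : Assignment m n} {i} f {k} → (∀ k → i ∉ S σ k) → k ≢ f →
               C (apply i (assign f) σ) k ≡ C σ k
  C-assign-≢ {σ} {i} f {k} i∉ k≢f = ℕ.≤-antisym (p⊆q⇒∣p∣≤∣q∣ back) (C-assign-≥ f k i∉)
    where
    back : S (apply i (assign f) σ) k ⊆ S σ k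
    back {j} j∈ with j Fin.≟ i
    ... | no j≢i   = proj₂ (S⇒kept (assign f) j≢i j∈)
    ... | yes refl = contradiction (S-disjoint j∈ (new∈S {σ} (assign f) refl)) k≢f

  C-replace : ∀ {σ : Assignment m n} {i J} f k → (∀ k → i ∉ S σ k) → J ∈ S σ f →
              C (apply i (replace J f) σ) k ≡ C σ k
  C-replace {σ} {i} {J} f k i∉ J∈ with k Fin.≟ f
  ... | yes refl = trans (cong ∣_∣ eq) (∣swap∣ J∈ (i∉ k))
    where
    eq : S (apply i (replace J k) σ) k ≡ swap (S σ k) J i
    eq = trans (map-[]≔ _ _ i) (cong₂ _[ i ]≔_ (map-[]≔ _ σ J)
      (dec-true (≡-dec Fin._≟_ (just k) (just k)) refl))
  ... | no k≢f = ℕ.≤-antisym (p⊆q⇒∣p∣≤∣q∣ back) (p⊆q⇒∣p∣≤∣q∣ forth)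
    where
    back : S (apply i (replace J f) σ) k ⊆ S σ k
    back {j} j∈ with j Fin.≟ i
    ... | no j≢i   = proj₂ (S⇒kept (replace J f) j≢i j∈)
    ... | yes refl = contradiction
      (S-disjoint j∈ (new∈S {σ} (replace J f) refl)) k≢f
    forth : S σ k ⊆ S (apply i (replace J f) σ) k
    forth {j} j∈ = kept⇒S (replace J f) (λ {refl → i∉ k j∈})
      (λ {refl → k≢f (S-disjoint j∈ J∈)}) j∈

  Balanced : Assignment m n → Set
  Balanced σ = ∀ i k → C σ k ℕ.≤ suc (C σ i)

  -- Dropping any one interval lowers the load by exactly one, so whichever interval witnesses
  -- nonemptiness will do.
  balanced⇒EF1 : ∀ {σ : Assignment m n} → Balanced σ → EF1 σ
  balanced⇒EF1 balanced i k _ (I , I∈) =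
    I , I∈ , ℕ.s≤s⁻¹ (subst (ℕ._≤ _) (x∈p⇒∣p∣≡1+∣p-x∣ I∈) (balanced i k))

  EF1⇒balanced : ∀ {σ : Assignment m n} → EF1 σ → Balanced σ
  EF1⇒balanced {σ} ef1 i k with i Fin.≟ k
  ... | yes refl = ℕ.n≤1+n _
  ... | no i≢k with nonempty? (S σ k)
  ...   | no empty = ℕ.≤-trans (ℕ.≤-reflexive (empty⇒∣p∣≡0 empty)) z≤n
  ...   | yes nonempty with ef1 i k i≢k nonempty
  ...     | I , I∈ , le = subst (ℕ._≤ _) (sym (x∈p⇒∣p∣≡1+∣p-x∣ I∈)) (s≤s le)

  -- Only the machine receiving the interval grows, and it was lowest.
  balanced-assign : ∀ {σ : Assignment m n} {i f} → (∀ k → i ∉ S σ k) →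
                    (∀ ℓ → C σ f ℕ.≤ C σ ℓ) → Balanced σ →
                    Balanced (apply i (assign f) σ)
  balanced-assign {σ} {i} {f} i∉ lowest balanced a b with b Fin.≟ f
  ... | yes refl = ℕ.≤-trans (ℕ.≤-reflexive (C-assign-≡ {σ = σ} b (i∉ b)))
    (s≤s (ℕ.≤-trans (lowest a) (C-assign-≥ {σ = σ} b a i∉)))
  ... | no b≢f = ℕ.≤-trans (ℕ.≤-reflexive (C-assign-≢ {σ = σ} f i∉ b≢f))
    (ℕ.≤-trans (balanced a b) (s≤s (C-assign-≥ {σ = σ} f a i∉)))

-- Schedules and Greedy-Optimal

module _ (𝓘 : Instance) where

  private
    n = size 𝓘
    s e : Fin n → ℚ
    s j = start (interval 𝓘 j)
    e j = end (interval 𝓘 j)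

  Active : ℚ → Fin n → Set
  Active x j = x ∈ᴵ interval 𝓘 j

  active? : ∀ x → Decidable (Active x)
  active? x j = s j ℚ.≤? x ×-dec x ℚ.<? e j

  active : ℚ → Subset n
  active x = subset (active? x)

  -- Arrivals are sorted by start time, so a common point can be moved left to `s i`. Together with
  -- `active⇒conflict` this lets every conflict with an arriving interval be tested at that single
  -- point.
  conflict⇒active : ∀ {j i} → j Fin.≤ i → Overlap (interval 𝓘 j) (interval 𝓘 i) → Active (s i) j
  conflict⇒active j≤i (x , (sj≤x , x<ej) , (si≤x , x<ei)) =
    sorted 𝓘 j≤i , ℚ.≤-<-trans si≤x x<ej

  active⇒conflict : ∀ {j i} → Active (s i) j → Overlap (interval 𝓘 j) (interval 𝓘 i)
  active⇒conflict {i = i} act = s i , act , (ℚ.≤-refl , start<end (interval 𝓘 i))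

  overlap-sym : ∀ {I J} → Overlap I J → Overlap J I
  overlap-sym (x , x∈I , x∈J) = x , x∈J , x∈I

  module _ {m : ℕ} where

    Arrived : ℕ → Assignment m n → Set
    Arrived t σ = ∀ {j k} → j ∈ S σ k → toℕ j ℕ.< t

    fresh : ∀ {σ} {i : Fin n} → Arrived (toℕ i) σ → ∀ k → i ∉ S σ k
    fresh arrived k i∈ = ℕ.<-irrefl refl (arrived i∈)

    arrived-apply : ∀ {σ i} a → Arrived (toℕ i) σ → Arrived (suc (toℕ i)) (apply i a σ)
    arrived-apply {σ} {i} a arrived {j} j∈ with j Fin.≟ i
    ... | yes refl = ℕ.≤-refl
    ... | no j≢i   = ℕ.m≤n⇒m≤1+n (arrived (proj₂ (S⇒kept {σ = σ} a j≢i j∈)))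

    -- Two intervals of one machine active at `x` would conflict there, so each of the `m` machines
    -- contributes at most one.
    active∣≤m : ∀ {σ : Assignment m n} {x} {T : Subset n} → IsSchedule 𝓘 σ →
                (∀ {j} → j ∈ T → ∃ λ k → j ∈ S σ k) → (∀ {j} → j ∈ T → Active x j) →
                ∣ T ∣ ℕ.≤ m
    active∣≤m {σ} {x} {T} schedule T⊆σ T-active =
      subst (∣ T ∣ ℕ.≤_) (ℕ.*-identityʳ m) (∣cover∣≤ U T covers single)
      where
      U : Fin m → Subset n
      U k = S σ k ∩ active x
      covers : ∀ {j} → j ∈ T → ∃ λ k → j ∈ U k
      covers j∈T with T⊆σ j∈T
      ... | k , j∈ = k , x∈p∩q⁺ (j∈ , ∈-subset⁺ (active? x) (T-active j∈T))
      single : ∀ k → ∣ U k ∣ ℕ.≤ 1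
      single k = subsingleton⇒∣p∣≤1 (U k) λ {j} {j′} j∈ j′∈ → same j∈ j′∈ (j Fin.≟ j′)
        where
        same : ∀ {j j′} → j ∈ U k → j′ ∈ U k → Dec (j ≡ j′) → j ≡ j′
        same j∈ j′∈ (yes j≡j′) = j≡j′
        same j∈ j′∈ (no j≢j′) with x∈p∩q⁻ (S σ k) (active x) j∈ | x∈p∩q⁻ (S σ k) (active x) j′∈
        ... | j∈S , j∈A | j′∈S , j′∈A = contradiction
          (x , ∈-subset⁻ (active? x) j∈A , ∈-subset⁻ (active? x) j′∈A)
          (schedule k j∈S j′∈S j≢j′)

    ¬fits⇒active : ∀ (σ : Assignment m n) {i k} → Arrived (toℕ i) σ → ¬ Fits 𝓘 σ i k →
                   ∃ λ J → J ∈ S σ k × Active (s i) J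
    ¬fits⇒active σ {i} {k} arrived blocked
      with any? (λ J → (J ∈? S σ k) ×-dec active? (s i) J)
    ... | yes found = found
    ... | no none   = ⊥-elim (blocked λ J∈ clash →
      none (_ , J∈ , conflict⇒active (ℕ.<⇒≤ (arrived J∈)) clash))

    record GreedyState (t : ℕ) (ε : Assignment m n) : Set where
      field
        arrived  : Arrived t ε
        schedule : IsSchedule 𝓘 ε

    greedy-step : ∀ {ε i a} → GreedyState (toℕ i) ε → GreedyOptimal 𝓘 ε i a →
                  GreedyState (suc (toℕ i)) (apply i a ε)
    greedy-step {ε} {i} {a} state action = record
      { arrived  = arrived-apply {ε} a arrived
      ; schedule = schedule′
      }
      where
      open GreedyState state
      clear : ∀ {a k j} → GreedyOptimal 𝓘 ε i a → i ∈ S (apply i a ε) k → ¬ Revokes a j →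
              j ∈ S ε k → ¬ Overlap (interval 𝓘 j) (interval 𝓘 i)
      clear {k = k} (accept {k₀} fits) i∈ kept j∈ =
        fits (subst (λ k → _ ∈ S ε k) (S-disjoint i∈ (new∈S {σ = ε} (assign k₀) refl)) j∈)
      -- The revoked leader `J` contains `s i`, because it started earlier and ends after `i`. Any
      -- other interval of its machine that meets `i` also contains `s i`, and would already have
      -- conflicted with `J`.
      clear {j = j} (revoke {k₀} {J} _ ((J∈ , _) , _) ei<eJ) i∈ j≢J j∈ clash =
        schedule k₀ j∈′ J∈ j≢J
          (s i , conflict⇒active (ℕ.<⇒≤ (arrived j∈)) clash ,
            (sorted 𝓘 (ℕ.<⇒≤ (arrived J∈)) , ℚ.<-trans (start<end (interval 𝓘 i)) ei<eJ))
        where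
        j∈′ : j ∈ S ε k₀
        j∈′ = subst (λ k → _ ∈ S ε k) (S-disjoint i∈ (new∈S {σ = ε} (replace J k₀) refl)) j∈
      clear (reject _ _) i∈ _ _ = contradiction i∈ (fresh {ε} arrived _)
      schedule′ : IsSchedule 𝓘 (apply i a ε)
      schedule′ k {j} {j′} j∈ j′∈ j≢j′ clash with j Fin.≟ i | j′ Fin.≟ i
      ... | yes refl | yes refl = j≢j′ refl
      ... | yes refl | no j′≢i  with S⇒kept {σ = ε} a j′≢i j′∈
      ...   | kept , j′∈ε = clear action j∈ kept j′∈ε (overlap-sym {interval 𝓘 j} {interval 𝓘 j′} clash)
      schedule′ k j∈ j′∈ j≢j′ clash | no j≢i | yes refl with S⇒kept {σ = ε} a j≢i j∈
      ...   | kept , j∈ε = clear action j′∈ kept j∈ε clash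
      schedule′ k j∈ j′∈ j≢j′ clash | no j≢i | no j′≢i =
        schedule k (proj₂ (S⇒kept {σ = ε} a j≢i j∈)) (proj₂ (S⇒kept {σ = ε} a j′≢i j′∈)) j≢j′ clash

    ∉S-initial : ∀ {j k} → j ∉ S (replicate n (nothing {A = Fin m})) k
    ∉S-initial {j} {k} j∈ with trans (sym (lookup-replicate j nothing)) (∈S⁻ j∈)
    ... | ()

    greedy-initial : GreedyState 0 (replicate n nothing)
    greedy-initial = record
      { arrived  = λ {j} {k} j∈ → contradiction j∈ ∉S-initial
      ; schedule = λ k i∈ _ _ _ → ∉S-initial i∈
      }

    greedy-run : ∀ {t ε σ} → Run 𝓘 t ε σ → GreedyState t ε
    greedy-run initially              = greedy-initial
    greedy-run (arrival i run greedy _) = greedy-step (greedy-run run) greedy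

    -- The exchange partner is only a set of depth at most `m`, not an assignment: an exchange then
    -- never has to redistribute intervals over machines. `agrees` is an inclusion in one direction,
    -- which after all arrivals already bounds `chosen` by Greedy-Optimal.
    record Extendable (size₀ t : ℕ) (ε : Assignment m n) : Set where
      field
        chosen : Subset n
        large  : size₀ ℕ.≤ ∣ chosen ∣
        depth  : ∀ x → ∣ chosen ∩ active x ∣ ℕ.≤ m
        agrees : ∀ {j} → j ∈ chosen → toℕ j ℕ.< t → ∃ λ k → j ∈ S ε k

    before-start : ∀ {i j x} → x < s i → Active x j → toℕ j ℕ.< toℕ i
    before-start x<si (sj≤x , _) =
      ℕ.≰⇒> λ i≤j → ℚ.<-irrefl refl (ℚ.<-≤-trans x<si (ℚ.≤-trans (sorted 𝓘 i≤j) sj≤x))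

    extend-same : ∀ {c ε ε′} {i : Fin n} (E : Extendable c (toℕ i) ε) (let open Extendable E) →
                  (∀ {j} → j ∈ chosen → j Fin.≤ i → ∃ λ k → j ∈ S ε′ k) →
                  Extendable c (suc (toℕ i)) ε′
    extend-same E agrees′ = record
      { Extendable E hiding (agrees)
      ; agrees = λ j∈ j≤i → agrees′ j∈ (ℕ.s≤s⁻¹ j≤i) }

    -- Exchanging a for b does not increase the depth from s i on, where a covers
    -- b; before s i only intervals held by Greedy-Optimal are active.
    extend-swap : ∀ {c ε ε′} {i : Fin n} (E : Extendable c (toℕ i) ε) (let open Extendable E) →
                  IsSchedule 𝓘 ε′ → ∀ {a b} → a ∈ chosen → b ∉ chosen →
                  a Fin.≤ i → e b ≤ e a →
                  (∀ {j} → j ∈ swap chosen a b → j Fin.≤ i → ∃ λ k → j ∈ S ε′ k) →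
                  Extendable c (suc (toℕ i)) ε′
    extend-swap {ε′ = ε′} {i} E schedule′ {a} {b} a∈ b∉ a≤i eb≤ea agrees′ = record
      { chosen = chosen′
      ; large  = subst (_ ℕ.≤_) (sym (∣swap∣ a∈ b∉)) large
      ; depth  = depth′
      ; agrees = λ j∈ j≤i → agrees′ j∈ (ℕ.s≤s⁻¹ j≤i)
      }
      where
      open Extendable E
      chosen′ = swap chosen a b
      depth′ : ∀ x → ∣ chosen′ ∩ active x ∣ ℕ.≤ m
      depth′ x with s i ℚ.≤? x
      ... | no si≰x = active∣≤m {ε′} {x} schedule′
        (λ {j} j∈ → let j∈′ , jx = x∈p∩q⁻ chosen′ (active x) j∈ in
          agrees′ j∈′ (ℕ.<⇒≤ (before-start (ℚ.≰⇒> si≰x) (∈-subset⁻ (active? x) jx))))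
        (λ j∈ → ∈-subset⁻ (active? x) (proj₂ (x∈p∩q⁻ chosen′ (active x) j∈)))
      ... | yes si≤x with b ∈? active x
      ...   | no b∉x = ℕ.≤-trans (p⊆q⇒∣p∣≤∣q∣ sub) (depth x)
        where
        sub : chosen′ ∩ active x ⊆ chosen ∩ active x
        sub j∈ with x∈p∩q⁻ chosen′ (active x) j∈
        ... | j∈′ , jx with ∈-swap⁻ j∈′
        ...   | inj₁ refl      = contradiction jx b∉x
        ...   | inj₂ (_ , j∈c) = x∈p∩q⁺ (j∈c , jx)
      ...   | yes b∈x = ℕ.≤-trans (p⊆q⇒∣p∣≤∣q∣ sub)
          (ℕ.≤-trans (ℕ.≤-reflexive (∣swap∣ a∈x b∉′)) (depth x))
        where
        a∈x : a ∈ chosen ∩ active x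
        a∈x = x∈p∩q⁺ (a∈ , ∈-subset⁺ (active? x)
          (ℚ.≤-trans (sorted 𝓘 a≤i) si≤x ,
           ℚ.<-≤-trans (proj₂ (∈-subset⁻ (active? x) b∈x)) eb≤ea))
        b∉′ : b ∉ chosen ∩ active x
        b∉′ = b∉ ∘ p∩q⊆p chosen (active x)
        sub : chosen′ ∩ active x ⊆ swap (chosen ∩ active x) a b
        sub {j} j∈ with x∈p∩q⁻ chosen′ (active x) j∈
        ... | j∈′ , jx with j Fin.≟ b | ∈-swap⁻ j∈′
        ...   | yes refl | _                = ∈-insert _ j
        ...   | no j≢b   | inj₁ j≡b         = contradiction j≡b j≢b
        ...   | no j≢b   | inj₂ (j≢a , j∈c) =
          ∈-update⁺ j≢b (∈-update⁺ j≢a (x∈p∩q⁺ (j∈c , jx)))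

    -- Each machine is blocked by an interval active at `s i`. If all of these were chosen, they and
    -- `i` would be `m + 1` chosen intervals active at `s i`, contradicting `depth`. The unchosen
    -- one is what an exchange can put in.
    blocked⇒spare : ∀ {c ε} {i : Fin n} (E : Extendable c (toℕ i) ε) (let open Extendable E) →
                    Arrived (toℕ i) ε → (∀ k → ¬ Fits 𝓘 ε i k) → i ∈ chosen →
                    ∃ λ J → (∃ λ k → J ∈ S ε k) × Active (s i) J × J ∉ chosen
    blocked⇒spare {ε = ε} {i} E arrived blocked i∈
      with any? (λ J → (J ∈? scheduled ε) ×-dec (active? (s i) J ×-dec ¬? (J ∈? Extendable.chosen E)))
    ... | yes (J , J∈ , act , J∉) = J , scheduled⇒S {σ = ε} J∈ , act , J∉
    ... | no none = contradiction (ℕ.≤-trans overfull (depth (s i))) ℕ.1+n≰n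
      where
      open Extendable E
      A = chosen ∩ active (s i)
      U : Fin m → Subset n
      U k = S ε k ∩ active (s i)
      within : ∀ k → U k ⊆ A [ i ]≔ outside
      within k {j} j∈ with x∈p∩q⁻ (S ε k) (active (s i)) j∈ | j ∈? chosen
      ... | j∈S , ja | yes j∈c = ∈-update⁺ (λ {refl → fresh {ε} arrived k j∈S}) (x∈p∩q⁺ (j∈c , ja))
      ... | j∈S , ja | no j∉c  =
        contradiction (j , S⊆scheduled {σ = ε} k j∈S , ∈-subset⁻ (active? (s i)) ja , j∉c) none
      occupied : ∀ k → 1 ℕ.≤ ∣ U k ∣
      occupied k with ¬fits⇒active ε arrived (blocked k)
      ... | J , J∈ , act = subst (ℕ._≤ ∣ U k ∣) (∣⁅x⁆∣≡1 J) (p⊆q⇒∣p∣≤∣q∣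
        λ j∈ → subst (_∈ U k) (sym (x∈⁅y⁆⇒x≡y J j∈)) (x∈p∩q⁺ (J∈ , ∈-subset⁺ (active? (s i)) act)))
      overfull : suc m ℕ.≤ ∣ A ∣
      overfull = begin
        suc m                       ≡⟨ cong suc (sym (ℕ.*-identityʳ m)) ⟩
        suc (m ℕ.* 1)               ≤⟨ s≤s (≤∣packing∣ U (A [ i ]≔ outside) within
                                         (λ {_} {k} {k′} j∈ j∈′ → S-disjoint {σ = ε}
                                           (p∩q⊆p (S ε k) _ j∈) (p∩q⊆p (S ε k′) _ j∈′))
                                         occupied) ⟩
        suc ∣ A [ i ]≔ outside ∣    ≡⟨ sym (∣delete∣ A i (x∈p∩q⁺ (i∈ , ∈-subset⁺ (active? (s i))
                                         (ℚ.≤-refl , start<end (interval 𝓘 i))))) ⟩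
        ∣ A ∣                       ∎
        where open ℕ.≤-Reasoning

    -- All held intervals have started by `s i`, so one on the same machine ending after `J` would
    -- contain `s i` as well and conflict with `J`. This makes a spare interval comparable with the
    -- largest leader.
    active⇒leader : ∀ {ε i k J} → GreedyState (toℕ i) ε → J ∈ S ε k → Active (s i) J →
                    Leader 𝓘 ε k J
    active⇒leader {ε} {i} {k} {J} state J∈ act = J∈ , largest
      where
      open GreedyState state
      largest : ∀ {J′} → J′ ∈ S ε k → e J′ ≤ e J
      largest {J′} J′∈ with J′ Fin.≟ J | e J′ ℚ.≤? e J
      ... | yes refl | _       = ℚ.≤-refl
      ... | no _     | yes le  = le
      ... | no J′≢J  | no nle  = contradiction
        (s i , (sorted 𝓘 (ℕ.<⇒≤ (arrived J′∈)) , ℚ.<-trans (proj₂ act) (ℚ.≰⇒> nle)) , act)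
        (schedule k J′∈ J∈ J′≢J)

    extend-step : ∀ {c ε i a} → GreedyState (toℕ i) ε → GreedyOptimal 𝓘 ε i a →
                  Extendable c (toℕ i) ε → Extendable c (suc (toℕ i)) (apply i a ε)
    extend-step {c} {ε} {i} {a} state greedy E = step greedy
      where
      open GreedyState state
      open Extendable E

      agrees′ : ∀ {j} a → j ∈ chosen → j ≢ i → ¬ Revokes a j → j Fin.≤ i →
                ∃ λ k → j ∈ S (apply i a ε) k
      agrees′ a j∈ j≢i kept j≤i with agrees j∈ (ℕ.≤∧≢⇒< j≤i (j≢i ∘ Fin.toℕ-injective))
      ... | k , j∈S = k , kept⇒S {σ = ε} a j≢i kept j∈S

      step : ∀ {a} → GreedyOptimal 𝓘 ε i a → Extendable c (suc (toℕ i)) (apply i a ε)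
      step (accept {k} fits) = extend-same E held
        where
        held : ∀ {j} → j ∈ chosen → j Fin.≤ i → ∃ λ k′ → j ∈ S (apply i (assign k) ε) k′
        held {j} j∈ j≤i with j Fin.≟ i
        ... | yes refl = k , new∈S {σ = ε} (assign k) refl
        ... | no j≢i   = agrees′ (assign k) j∈ j≢i (λ ()) j≤i
      step action@(revoke {k} {J} blocked ((J∈ , J-leads) , largest) ei<eJ)
        with J ∈? chosen | i ∈? chosen
      -- The revoked interval is not chosen, so the chosen set survives unchanged, whether or not it
      -- contains `i`.
      ... | no J∉c | _ = extend-same E held
        where
        held : ∀ {j} → j ∈ chosen → j Fin.≤ i → ∃ λ k′ → j ∈ S (apply i (replace J k) ε) k′
        held {j} j∈ j≤i with j Fin.≟ i
        ... | yes refl = k , new∈S {σ = ε} (replace J k) refl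
        ... | no j≢i   = agrees′ (replace J k) j∈ j≢i (λ {refl → J∉c j∈}) j≤i
      -- Trade `J` for `i`, following Greedy-Optimal; `i` ends earlier.
      ... | yes J∈c | no i∉c =
        extend-swap E (GreedyState.schedule (greedy-step state action)) J∈c i∉c
          (ℕ.<⇒≤ (arrived J∈)) (ℚ.<⇒≤ ei<eJ) held
        where
        held : ∀ {j} → j ∈ swap chosen J i → j Fin.≤ i → ∃ λ k′ → j ∈ S (apply i (replace J k) ε) k′
        held {j} j∈ j≤i with j Fin.≟ i | ∈-swap⁻ {p = chosen} {J} {i} j∈
        ... | yes refl | _                = k , new∈S {σ = ε} (replace J k) refl
        ... | no j≢i   | inj₁ j≡i         = contradiction j≡i j≢i
        ... | no j≢i   | inj₂ (j≢J , j∈c) = agrees′ (replace J k) j∈c j≢i j≢J j≤i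
      -- With `i` already chosen, `J` is traded for a spare interval instead. The spare one leads
      -- its machine, hence ends no later than the largest leader `J`.
      ... | yes J∈c | yes i∈c with blocked⇒spare E arrived blocked i∈c
      ...   | J′ , (k₁ , J′∈) , act , J′∉c =
        extend-swap E (GreedyState.schedule (greedy-step state action)) J∈c J′∉c
          (ℕ.<⇒≤ (arrived J∈)) (largest (active⇒leader state J′∈ act)) held
        where
        held : ∀ {j} → j ∈ swap chosen J J′ → j Fin.≤ i → ∃ λ k′ → j ∈ S (apply i (replace J k) ε) k′
        held {j} j∈ j≤i with j Fin.≟ i | ∈-swap⁻ {p = chosen} {J} {J′} j∈
        ... | yes refl | _                = k , new∈S {σ = ε} (replace J k) refl
        ... | no j≢i   | inj₁ refl        =
          k₁ , kept⇒S {σ = ε} (replace J k) j≢i (λ {refl → J′∉c J∈c}) J′∈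
        ... | no j≢i   | inj₂ (j≢J , j∈c) = agrees′ (replace J k) j∈c j≢i j≢J j≤i
      step action@(reject blocked no-larger) with i ∈? chosen
      ... | no i∉c = extend-same E λ j∈ → agrees′ reject j∈ (λ {refl → i∉c j∈}) (λ ())
      -- The rejected `i` has to leave the chosen set; it is traded for a spare interval.
      ... | yes i∈c with blocked⇒spare E arrived blocked i∈c
      ...   | J′ , (k₁ , J′∈) , act , J′∉c =
        extend-swap E schedule i∈c J′∉c ℕ.≤-refl (ℚ.≤-trans eJ′≤eJ eJ≤ei) held
        where
        -- The rejection rule speaks of a largest leader only. A held interval of maximum end time
        -- is one, and so the spare interval ends no later than `i`.
        maximal = ∃argmax e (scheduled ε) (S⊆scheduled {σ = ε} k₁ J′∈)
        J = proj₁ maximal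
        J-max : ∀ {k j} → j ∈ S ε k → e j ≤ e J
        J-max j∈ = proj₂ (proj₂ maximal) (S⊆scheduled {σ = ε} _ j∈)
        eJ′≤eJ : e J′ ≤ e J
        eJ′≤eJ = J-max J′∈
        eJ≤ei : e J ≤ e i
        eJ≤ei with scheduled⇒S {σ = ε} (proj₁ (proj₂ maximal))
        ... | k , J∈ = ℚ.≮⇒≥ (no-larger {k} {J} ((J∈ , J-max) , λ leader → J-max (proj₁ leader)))
        held : ∀ {j} → j ∈ swap chosen i J′ → j Fin.≤ i → ∃ λ k′ → j ∈ S ε k′
        held {j} j∈ j≤i with ∈-swap⁻ {p = chosen} {i} {J′} j∈
        ... | inj₁ refl        = k₁ , J′∈
        ... | inj₂ (j≢i , j∈c) = agrees′ reject j∈c j≢i (λ ()) j≤i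

    -- The chosen set starts as the intervals of `τ` itself, where agreement is vacuous because
    -- nothing has arrived.
    extend-run : ∀ {t ε σ} {τ : Assignment m n} → IsSchedule 𝓘 τ → Run 𝓘 t ε σ →
                 Extendable ∣ scheduled τ ∣ t ε
    extend-run {τ = τ} schedule initially = record
      { chosen = scheduled τ
      ; large  = ℕ.≤-refl
      ; depth  = λ x → active∣≤m {τ} {x} schedule
          (λ j∈ → scheduled⇒S {σ = τ} (p∩q⊆p (scheduled τ) (active x) j∈))
          (λ j∈ → ∈-subset⁻ (active? x) (p∩q⊆q (scheduled τ) (active x) j∈))
      ; agrees = λ _ ()
      }
    extend-run schedule (arrival i run greedy _) =
      extend-step (greedy-run run) greedy (extend-run schedule run)

    -- Once everything has arrived, `agrees` applies to every chosen interval, so a set at least as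
    -- large as `τ` lies within `scheduled ε`.
    greedy-optimal : ∀ {ε σ} {τ : Assignment m n} → IsSchedule 𝓘 τ → Run 𝓘 n ε σ →
                     ∣ scheduled τ ∣ ℕ.≤ ∣ scheduled ε ∣
    greedy-optimal {ε} schedule run = ℕ.≤-trans large (p⊆q⇒∣p∣≤∣q∣ λ {j} j∈ →
      let k , j∈S = agrees j∈ (Fin.toℕ<n j) in S⊆scheduled {σ = ε} k j∈S)
      where open Extendable (extend-run schedule run)

    -- Greedy-Balanced

    -- Through `held`, intervals of Greedy-Balanced count against the depth of Greedy-Optimal
    -- together with the lost ones.
    record BalancedState (t : ℕ) (ε σ : Assignment m n) : Set where
      field
        arrived  : Arrived t σ
        held     : ∀ {j k} → j ∈ S σ k → ∃ λ k′ → j ∈ S ε k′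
        balanced : Balanced σ

    balanced-step : ∀ {ε σ i a b} → BalancedState (toℕ i) ε σ → GreedyBalanced 𝓘 σ i a b →
                    BalancedState (suc (toℕ i)) (apply i a ε) (apply i b σ)
    balanced-step {ε} {σ} {i} {a} {b} state action = record
      { arrived  = arrived-apply {σ} b arrived
      ; held     = held′
      ; balanced = balanced′ action
      }
      where
      open BalancedState state

      -- This is the purpose of the filter: when Greedy-Optimal revokes an interval, passing the
      -- filter requires that Greedy-Balanced does not hold it.
      revoked-too : ∀ {a b j k} → GreedyBalanced 𝓘 σ i a b → j ∈ S σ k → Revokes a j → Revokes b j
      revoked-too (filter-revoke _)                   j∈ rev  = rev
      revoked-too (place (revoked unheld) _)          j∈ refl = contradiction j∈ (unheld _)
      revoked-too (repair (revoked unheld) _ _ _)     j∈ refl = contradiction j∈ (unheld _)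
      revoked-too (reject (revoked unheld) _ _)       j∈ refl = contradiction j∈ (unheld _)

      passes⇒schedules : ∀ {a} → Passes 𝓘 σ a → ∃ (Schedules a)
      passes⇒schedules (accepted {k})    = k , refl
      passes⇒schedules (revoked {k = k} _) = k , refl

      scheduled-too : ∀ {a b k} → GreedyBalanced 𝓘 σ i a b → i ∈ S (apply i b σ) k → ∃ (Schedules a)
      scheduled-too filter-reject                 i∈ = contradiction i∈ (fresh {σ = σ} arrived _)
      scheduled-too (filter-revoke {k′ = k′} _)   i∈ = k′ , refl
      scheduled-too (place passes _)              i∈ = passes⇒schedules passes
      scheduled-too (repair passes _ _ _)         i∈ = passes⇒schedules passes
      scheduled-too (reject passes _ _)           i∈ = passes⇒schedules passes

      held′ : ∀ {j k} → j ∈ S (apply i b σ) k → ∃ λ k′ → j ∈ S (apply i a ε) k′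
      held′ {j} j∈ with j Fin.≟ i
      ... | yes refl = let k′ , sch = scheduled-too action j∈ in k′ , new∈S {σ = ε} a sch
      ... | no j≢i with S⇒kept {σ = σ} b j≢i j∈
      ...   | kept , j∈σ =
        let k′ , j∈ε = held j∈σ in k′ , kept⇒S {σ = ε} a j≢i (kept ∘ revoked-too action j∈σ) j∈ε

      balanced-replace : ∀ {J k} → J ∈ S σ k → Balanced (apply i (replace J k) σ)
      balanced-replace {J} {k} J∈ x y =
        subst (ℕ._≤ _) (sym (C-replace {σ = σ} k y (fresh {σ = σ} arrived) J∈))
          (subst (λ c → C σ y ℕ.≤ suc c) (sym (C-replace {σ = σ} k x (fresh {σ = σ} arrived) J∈))
            (balanced x y))

      balanced′ : ∀ {a b} → GreedyBalanced 𝓘 σ i a b → Balanced (apply i b σ)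
      balanced′ filter-reject                    = balanced
      balanced′ (filter-revoke J∈)               = balanced-replace J∈
      balanced′ (place {f = f} _ (_ , _ , ef1))  = EF1⇒balanced {σ = apply i (assign f) σ} ef1
      balanced′ (repair _ _ (_ , J∈ , _) _)      = balanced-replace J∈
      balanced′ (reject _ _ _)                   = balanced

    balanced-run : ∀ {t ε σ} → Run 𝓘 t ε σ → BalancedState t ε σ
    balanced-run initially = record
      { arrived  = λ j∈ → contradiction j∈ ∉S-initial
      ; held     = λ j∈ → contradiction j∈ ∉S-initial
      ; balanced = λ i k → ℕ.≤-trans
          (ℕ.≤-reflexive (empty⇒∣p∣≡0 λ (_ , j∈) → ∉S-initial j∈)) z≤n
      }
    balanced-run (arrival i run _ action) = balanced-step (balanced-run run) action

    -- Lost intervals and how they compare with machines of low load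

    lost : Assignment m n → Assignment m n → Subset n
    lost ε σ = scheduled ε ─ scheduled σ

    ∈-lost⁺ : ∀ {ε σ j k} → j ∈ S ε k → (∀ k → j ∉ S σ k) → j ∈ lost ε σ
    ∈-lost⁺ {ε} {σ} {k = k} j∈ j∉ = x∈p∧x∉q⇒x∈p─q (S⊆scheduled {σ = ε} k j∈)
      λ j∈σ → let k , j∈S = scheduled⇒S {σ = σ} j∈σ in j∉ k j∈S

    ∈-lost⁻ : ∀ ε σ {j} → j ∈ lost ε σ → (∃ λ k → j ∈ S ε k) × (∀ k → j ∉ S σ k)
    ∈-lost⁻ ε σ j∈ = scheduled⇒S {σ = ε} (p─q⊆p (scheduled ε) (scheduled σ) j∈) ,
      λ k j∈S → x∈p─q⇒x∉q (scheduled ε) (scheduled σ) j∈ (S⊆scheduled {σ = σ} k j∈S)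

    -- Read contrapositively: the lost set gains at most the arriving interval and the one that
    -- Greedy-Balanced revokes.
    lost-apply : ∀ {ε σ i j} a b → j ≢ i → j ∈ lost (apply i a ε) (apply i b σ) →
                 ¬ Revokes b j → j ∈ lost ε σ
    lost-apply {ε} {σ} {i} a b j≢i j∈ kept with ∈-lost⁻ (apply i a ε) (apply i b σ) j∈
    ... | (k , j∈ε′) , j∉σ′ = ∈-lost⁺ {σ = σ} (proj₂ (S⇒kept {σ = ε} a j≢i j∈ε′))
      λ k j∈σ → j∉σ′ k (kept⇒S {σ = σ} b j≢i kept j∈σ)

    new∉lost : ∀ {ε σ i j k} a b → Schedules b k → j ∈ lost (apply i a ε) (apply i b σ) → j ≢ i
    new∉lost {ε} {σ} {i} a b sch j∈ refl =
      proj₂ (∈-lost⁻ (apply i a ε) (apply i b σ) j∈) _ (new∈S {σ = σ} b sch)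

    -- For `L` a lower bound on the loads, only machines of load exactly `L` matter. The condition
    -- becomes vacuous once all loads exceed `L`.
    Dominates : Assignment m n → ℕ → Fin n → Set
    Dominates σ L X = ∀ {k J} → C σ k ℕ.≤ L → J ∈ S σ k → e J ≤ e X

    infix 4 _≼_

    -- This is the monotonicity of Greedy-Balanced from one state to the next. `earlier` is
    -- restricted to machines whose load has not grown, since an assigned interval may end
    -- arbitrarily late, whereas a replacement brings in an earlier end.
    record _≼_ (σ σ′ : Assignment m n) : Set where
      field
        C-mono : ∀ k → C σ k ℕ.≤ C σ′ k
        earlier : ∀ {k J′} → C σ′ k ℕ.≤ C σ k → J′ ∈ S σ′ k → ∃ λ J → J ∈ S σ k × e J′ ≤ e J

    -- A machine of load at most `L` afterwards had load at least `L` before, so its load has not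
    -- grown and `earlier` applies to it.
    dominates-≼ : ∀ {σ σ′ L X} → (∀ k → L ℕ.≤ C σ k) → σ ≼ σ′ → Dominates σ L X → Dominates σ′ L X
    dominates-≼ floor≤ σ≼σ′ dom {k} low J′∈
      with _≼_.earlier σ≼σ′ (ℕ.≤-trans low (floor≤ k)) J′∈
    ... | J , J∈ , le = ℚ.≤-trans le (dom (ℕ.≤-trans (_≼_.C-mono σ≼σ′ k) low) J∈)

    ≼-refl : ∀ {σ} → σ ≼ σ
    ≼-refl = record { C-mono = λ _ → ℕ.≤-refl ; earlier = λ _ J∈ → _ , J∈ , ℚ.≤-refl }

    ≼-assign : ∀ {σ i} f → (∀ k → i ∉ S σ k) → σ ≼ apply i (assign f) σ
    ≼-assign {σ} {i} f i∉ = record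
      { C-mono  = λ k → C-assign-≥ {σ = σ} f k i∉
      ; earlier = earlier
      }
      where
      earlier : ∀ {k J′} → C (apply i (assign f) σ) k ℕ.≤ C σ k → J′ ∈ S (apply i (assign f) σ) k →
                ∃ λ J → J ∈ S σ k × e J′ ≤ e J
      earlier {k} {J′} low J′∈ with J′ Fin.≟ i
      ... | no J′≢i  = J′ , proj₂ (S⇒kept {σ = σ} (assign f) J′≢i J′∈) , ℚ.≤-refl
      ... | yes refl with S-disjoint J′∈ (new∈S {σ = σ} (assign f) refl)
      ...   | refl = contradiction (subst (ℕ._≤ C σ k) (C-assign-≡ {σ = σ} k (i∉ k)) low) ℕ.1+n≰n

    ≼-replace : ∀ {σ i J f} → (∀ k → i ∉ S σ k) → J ∈ S σ f → e i < e J →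
                σ ≼ apply i (replace J f) σ
    ≼-replace {σ} {i} {J} {f} i∉ J∈ ei<eJ = record
      { C-mono  = λ k → ℕ.≤-reflexive (sym (C-replace {σ = σ} f k i∉ J∈))
      ; earlier = λ _ → earlier
      }
      where
      earlier : ∀ {k J′} → J′ ∈ S (apply i (replace J f) σ) k → ∃ λ J → J ∈ S σ k × e J′ ≤ e J
      earlier {k} {J′} J′∈ with J′ Fin.≟ i
      ... | no J′≢i  = J′ , proj₂ (S⇒kept {σ = σ} (replace J f) J′≢i J′∈) , ℚ.≤-refl
      ... | yes refl with S-disjoint J′∈ (new∈S {σ = σ} (replace J f) refl)
      ...   | refl = J , J∈ , ℚ.<⇒≤ ei<eJ

  -- Bounding the lost intervals level by level, with `suc p` machines

  module _ {p : ℕ} where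

    private
      Asg = Assignment (suc p) n

    -- old holds the intervals lost before the minimum load reached floor.
    record Deficit (ε σ : Asg) (floor : ℕ) : Set where
      field
        floor≤ : ∀ k → floor ℕ.≤ C σ k
        lost≤  : ∣ lost ε σ ∣ ℕ.≤ p ℕ.* floor
        old    : Subset n
        old≤   : ∣ old ∣ ℕ.≤ p ℕ.* pred floor
        recent : ∀ {X} → X ∈ lost ε σ → X ∉ old → Dominates σ floor X

    -- The floor may lag behind the minimum load and is updated only when a loss is due. If it
    -- really rises, everything lost so far becomes old: the bound `p * L` is within
    -- `p * pred (C σ k)`, and no recent interval remains.
    raise-floor : ∀ {ε σ L k} → (∀ ℓ → C σ k ℕ.≤ C σ ℓ) → Deficit ε σ L → Deficit ε σ (C σ k)
    raise-floor {ε} {σ} {L} {k} lowest deficit with ℕ.m≤n⇒m<n∨m≡n (Deficit.floor≤ deficit k)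
    ... | inj₂ refl = deficit
    ... | inj₁ L<C  = record
      { floor≤ = lowest
      ; lost≤  = ℕ.≤-trans lost≤ (ℕ.*-monoʳ-≤ p (ℕ.<⇒≤ L<C))
      ; old    = lost ε σ
      ; old≤   = ℕ.≤-trans lost≤ (ℕ.*-monoʳ-≤ p (ℕ.pred-mono-≤ L<C))
      ; recent = λ X∈ X∉ → contradiction X∈ X∉
      }
      where open Deficit deficit

    -- This covers the arrivals at which no interval is newly lost.
    deficit-≼ : ∀ {ε σ ε′ σ′ L} → σ ≼ σ′ → lost ε′ σ′ ⊆ lost ε σ →
                Deficit ε σ L → Deficit ε′ σ′ L
    deficit-≼ {σ = σ} {σ′ = σ′} σ≼σ′ sub deficit = record
      { floor≤ = λ k → ℕ.≤-trans (floor≤ k) (_≼_.C-mono σ≼σ′ k)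
      ; lost≤  = ℕ.≤-trans (p⊆q⇒∣p∣≤∣q∣ sub) lost≤
      ; old    = old
      ; old≤   = old≤
      ; recent = λ X∈ X∉ → dominates-≼ {σ = σ} {σ′} floor≤ σ≼σ′ (recent (sub X∈) X∉)
      }
      where open Deficit deficit

    -- The recently lost intervals end no earlier than y, so they are active at
    -- s i together with y, which leaves room for at most p of them.
    deficit-grow : ∀ {i : Fin n} {ε σ ε′ σ′ L k y} →
                   GreedyState (suc (toℕ i)) ε′ → BalancedState (suc (toℕ i)) ε′ σ′ →
                   σ ≼ σ′ → (∀ {X} → X ∈ lost ε′ σ′ → X ∈ lost ε σ ⊎ Dominates σ′ L X) →
                   C σ′ k ℕ.≤ L → y ∈ S σ′ k → Active (s i) y →
                   Deficit ε σ L → Deficit ε′ σ′ L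
    deficit-grow {i} {ε} {σ} {ε′} {σ′} {L} {k} {y} greedy balanced σ≼σ′ split low y∈ y-active deficit =
      record
      { floor≤ = λ k → ℕ.≤-trans (floor≤ k) (_≼_.C-mono σ≼σ′ k)
      ; lost≤  = lost≤′
      ; old    = old
      ; old≤   = old≤
      ; recent = recent′
      }
      where
      open Deficit deficit
      open GreedyState greedy

      recent′ : ∀ {X} → X ∈ lost ε′ σ′ → X ∉ old → Dominates σ′ L X
      recent′ X∈ X∉ with split X∈
      ... | inj₁ X∈lost = dominates-≼ {σ = σ} {σ′} floor≤ σ≼σ′ (recent X∈lost X∉)
      ... | inj₂ dom    = dom

      R T : Subset n
      R = lost ε′ σ′ ─ old
      T = R [ y ]≔ inside

      y∉R : y ∉ R
      y∉R y∈R = proj₂ (∈-lost⁻ ε′ σ′ (p─q⊆p (lost ε′ σ′) old y∈R)) k y∈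

      T⊆ε′ : ∀ {j} → j ∈ T → ∃ λ k → j ∈ S ε′ k
      T⊆ε′ {j} j∈ with j Fin.≟ y
      ... | yes refl = BalancedState.held balanced y∈
      ... | no j≢y   = proj₁ (∈-lost⁻ ε′ σ′ (p─q⊆p (lost ε′ σ′) old (∈-update⁻ j≢y j∈)))

      T-active : ∀ {j} → j ∈ T → Active (s i) j
      T-active {j} j∈ with j Fin.≟ y
      ... | yes refl = y-active
      ... | no j≢y   = let j∈R = ∈-update⁻ j≢y j∈ ; k′ , j∈ε′ = T⊆ε′ j∈ in
        sorted 𝓘 (ℕ.s≤s⁻¹ (arrived j∈ε′)) ,
        ℚ.<-≤-trans (proj₂ y-active)
          (recent′ (p─q⊆p (lost ε′ σ′) old j∈R) (x∈p─q⇒x∉q (lost ε′ σ′) old j∈R) low y∈)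

      ∣R∣≤p : ∣ R ∣ ℕ.≤ p
      ∣R∣≤p = ℕ.s≤s⁻¹ (subst (ℕ._≤ suc p) (∣insert∣ R y y∉R)
        (active∣≤m {σ = ε′} {s i} schedule T⊆ε′ T-active))

      -- The machine holding `y` has load at most `L`, so `L` is positive. At `L = 0` the truncated
      -- `pred L` would leave no room for the `p` recent intervals.
      L≢0 : NonZero L
      L≢0 = ℕ.>-nonZero (ℕ.≤-trans (ℕ.≤-trans (s≤s z≤n) (x∈p⇒∣p-x∣<∣p∣ y∈)) low)

      lost≤′ : ∣ lost ε′ σ′ ∣ ℕ.≤ p ℕ.* L
      lost≤′ = begin
        ∣ lost ε′ σ′ ∣                       ≡⟨ ∣p∣≡∣p∩q∣+∣p─q∣ (lost ε′ σ′) old ⟩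
        ∣ lost ε′ σ′ ∩ old ∣ ℕ.+ ∣ R ∣       ≤⟨ ℕ.+-mono-≤ (ℕ.≤-trans (∣p∩q∣≤∣q∣ (lost ε′ σ′) old) old≤) ∣R∣≤p ⟩
        p ℕ.* pred L ℕ.+ p                   ≡⟨ ℕ.+-comm _ p ⟩
        p ℕ.+ p ℕ.* pred L                   ≡⟨ sym (ℕ.*-suc p (pred L)) ⟩
        p ℕ.* suc (pred L)                   ≡⟨ cong (p ℕ.*_) (ℕ.suc-pred L {{L≢0}}) ⟩
        p ℕ.* L                              ∎
        where open ℕ.≤-Reasoning

    -- Only repair and rejection past the filter lose an interval, and for these the floor is first
    -- raised to the minimum load. Repair loses `J`, and the newcomer serves as the active interval
    -- that is kept; rejection loses `i`, and a blocker on a lowest machine serves.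
    deficit-step : ∀ {ε σ i a b L} → GreedyState (toℕ i) ε → BalancedState (toℕ i) ε σ →
                   GreedyOptimal 𝓘 ε i a → GreedyBalanced 𝓘 σ i a b →
                   Deficit ε σ L → ∃ (Deficit (apply i a ε) (apply i b σ))
    deficit-step {ε} {σ} {i} greedy state optimal action deficit = step optimal action
      where
      open BalancedState state

      i∉ : ∀ k → i ∉ S σ k
      i∉ = fresh {σ = σ} arrived

      -- A held interval ending after `i` started no later than `i`, hence overlaps it. So on a
      -- lowest machine the end time alone decides whether it is a repair candidate.
      e≤⊎candidate : ∀ {k J} → (∀ ℓ → C σ k ℕ.≤ C σ ℓ) → J ∈ S σ k →
                     e J ≤ e i ⊎ RepairCandidate 𝓘 σ i k J
      e≤⊎candidate {k} {J} lowest J∈ with e i ℚ.<? e J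
      ... | no ≮      = inj₁ (ℚ.≮⇒≥ ≮)
      ... | yes ei<eJ = inj₂ (lowest , J∈ , active⇒conflict
        (sorted 𝓘 (ℕ.<⇒≤ (arrived J∈)) , ℚ.<-trans (start<end (interval 𝓘 i)) ei<eJ) , ei<eJ)

      step : ∀ {a b} → GreedyOptimal 𝓘 ε i a → GreedyBalanced 𝓘 σ i a b →
             ∃ (Deficit (apply i a ε) (apply i b σ))
      step _ filter-reject = _ , deficit
      step (revoke _ _ ei<eJ) (filter-revoke {J} {k} {k′} J∈) =
        _ , deficit-≼ {ε} {σ} {ε′} {σ′} (≼-replace {σ = σ} i∉ J∈ ei<eJ) sub deficit
        where
        ε′ = apply i (replace J k′) ε
        σ′ = apply i (replace J k) σ
        sub : lost ε′ σ′ ⊆ lost ε σ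
        sub {X} X∈ = lost-apply {ε = ε} {σ} (replace J k′) (replace J k) X≢i X∈
          -- Both algorithms revoke the same `J`, possibly on different machines, and `Revokes`
          -- ignores the machine. An interval that Greedy-Optimal still holds is therefore not
          -- revoked by Greedy-Balanced either.
          (proj₁ (S⇒kept {σ = ε} (replace J k′) X≢i (proj₂ (proj₁ (∈-lost⁻ ε′ σ′ X∈)))))
          where
          X≢i : X ≢ i
          X≢i = new∉lost {ε = ε} {σ} (replace J k′) (replace J k) refl X∈
      step {a} _ (place {f = f} _ _) = _ ,
        deficit-≼ {ε} {σ} {apply i a ε} {apply i (assign f) σ} (≼-assign {σ = σ} f i∉)
        (λ X∈ → lost-apply {ε = ε} {σ} a (assign f)
          (new∉lost {ε = ε} {σ} a (assign f) refl X∈) X∈ (λ ())) deficit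
      step {a} optimal action@(repair {k = k} {J} _ _ (lowest , J∈ , clash , ei<eJ) maximal) =
        _ , deficit-grow {i} {ε} {σ} {apply i a ε} {apply i (replace J k) σ}
          (greedy-step greedy optimal) (balanced-step state action)
          (≼-replace {σ = σ} i∉ J∈ ei<eJ) split
          (ℕ.≤-reflexive (C-replace {σ = σ} k k i∉ J∈)) (new∈S {σ = σ} (replace J k) refl)
          (ℚ.≤-refl , start<end (interval 𝓘 i)) (raise-floor {ε} {σ} lowest deficit)
        where
        -- What sits on a lowest machine now is `i`, an interval ending no later than `i`, or a
        -- candidate; the maximal choice of `J` handles the last.
        dominates : Dominates (apply i (replace J k) σ) (C σ k) J
        dominates {ℓ} {J′} low J′∈ with J′ Fin.≟ i
        ... | yes refl = ℚ.<⇒≤ ei<eJ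
        ... | no J′≢i with S⇒kept {σ = σ} (replace J k) J′≢i J′∈
        ...   | _ , J′∈σ with e≤⊎candidate (λ ℓ′ → ℕ.≤-trans
                  (subst (ℕ._≤ C σ k) (C-replace {σ = σ} k ℓ i∉ J∈) low) (lowest ℓ′)) J′∈σ
        ...     | inj₁ eJ′≤ei    = ℚ.≤-trans eJ′≤ei (ℚ.<⇒≤ ei<eJ)
        ...     | inj₂ candidate = maximal candidate
        split : ∀ {X} → X ∈ lost (apply i a ε) (apply i (replace J k) σ) →
                X ∈ lost ε σ ⊎ Dominates (apply i (replace J k) σ) (C σ k) X
        split {X} X∈ with X Fin.≟ J
        ... | yes refl = inj₂ dominates
        ... | no X≢J   = inj₁ (lost-apply {ε = ε} {σ} a (replace J k)
          (new∉lost {ε = ε} {σ} a (replace J k) refl X∈) X∈ X≢J)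
      -- Placing `i` on a machine of minimum load would preserve EF1, so the failed placement means
      -- that `i` does not fit there: an interval `y` on that machine is active at `s i`.
      step {a} optimal action@(reject _ unplaceable irreparable) with ∃argmin (C σ)
      ... | k , lowest with ¬fits⇒active σ arrived (λ fits → unplaceable k
              (fits , (λ ℓ _ → lowest ℓ) , balanced⇒EF1 {σ = apply i (assign k) σ}
                (balanced-assign {σ = σ} i∉ lowest balanced)))
      ...   | y , y∈ , y-active = _ , deficit-grow {i} {ε} {σ} {apply i a ε} {σ}
        (greedy-step greedy optimal) (balanced-step state action)
        (≼-refl {σ = σ}) split ℕ.≤-refl y∈ y-active (raise-floor {ε} {σ} lowest deficit)
        where
        dominates : Dominates σ (C σ k) i
        dominates low J∈ with e≤⊎candidate (λ ℓ → ℕ.≤-trans low (lowest ℓ)) J∈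
        ... | inj₁ eJ≤ei     = eJ≤ei
        ... | inj₂ candidate = contradiction candidate (irreparable _ _)
        split : ∀ {X} → X ∈ lost (apply i a ε) σ → X ∈ lost ε σ ⊎ Dominates σ (C σ k) X
        split {X} X∈ with X Fin.≟ i
        ... | yes refl = inj₂ dominates
        ... | no X≢i   = inj₁ (lost-apply {ε = ε} {σ} a reject X≢i X∈ (λ ()))

    deficit-run : ∀ {t ε σ} → Run 𝓘 t ε σ → ∃ (Deficit ε σ)
    deficit-run initially = 0 , record
      { floor≤ = λ _ → z≤n
      ; lost≤  = ℕ.≤-trans (ℕ.≤-reflexive (empty⇒∣p∣≡0 none)) z≤n
      ; old    = lost ε₀ ε₀
      ; old≤   = ℕ.≤-trans (ℕ.≤-reflexive (empty⇒∣p∣≡0 none)) z≤n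
      ; recent = λ X∈ X∉ → contradiction X∈ X∉
      }
      where
      ε₀ : Asg
      ε₀ = replicate n nothing
      none : Empty (lost ε₀ ε₀)
      none (_ , j∈) = ∉S-initial (proj₂ (proj₁ (∈-lost⁻ ε₀ ε₀ j∈)))
    deficit-run (arrival i run optimal action) = deficit-step
      (greedy-run run) (balanced-run run) optimal action (proj₂ (deficit-run run))

    -- The factor `2 - 1/m` is `(p + m) / m` with the denominator cleared. It comes from at most
    -- `p * L` lost intervals against at least `m * L` scheduled ones.
    competitive : ∀ {t ε σ} → Run 𝓘 t ε σ →
                  suc p ℕ.* ∣ scheduled ε ∣ ℕ.≤ (p ℕ.+ suc p) ℕ.* ∣ scheduled σ ∣
    competitive {ε = ε} {σ} run with deficit-run run
    ... | L , deficit = begin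
      m ℕ.* ∣ E ∣                              ≡⟨ cong (m ℕ.*_) (∣p∣≡∣p∩q∣+∣p─q∣ E A) ⟩
      m ℕ.* (∣ E ∩ A ∣ ℕ.+ ∣ E ─ A ∣)          ≤⟨ ℕ.*-monoʳ-≤ m (ℕ.+-mono-≤ (∣p∩q∣≤∣q∣ E A) lost≤) ⟩
      m ℕ.* (∣ A ∣ ℕ.+ p ℕ.* L)                ≡⟨ solve 3 (λ p a l → (con 1 :+ p) :* (a :+ p :* l) :=
                                                   p :* ((con 1 :+ p) :* l) :+ (con 1 :+ p) :* a)
                                                   refl p ∣ A ∣ L ⟩
      p ℕ.* (m ℕ.* L) ℕ.+ m ℕ.* ∣ A ∣          ≤⟨ ℕ.+-monoˡ-≤ _ (ℕ.*-monoʳ-≤ p loads) ⟩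
      p ℕ.* ∣ A ∣ ℕ.+ m ℕ.* ∣ A ∣              ≡⟨ sym (ℕ.*-distribʳ-+ ∣ A ∣ p m) ⟩
      (p ℕ.+ m) ℕ.* ∣ A ∣                      ∎
      where
      open ℕ.≤-Reasoning
      open Deficit deficit
      open +-*-Solver
      m = suc p
      E = scheduled ε
      A = scheduled σ
      loads : m ℕ.* L ℕ.≤ ∣ A ∣
      loads = ≤∣packing∣ (S σ) A (S⊆scheduled {σ = σ}) (S-disjoint {σ = σ}) floor≤

-- From natural numbers to the rational bound

2-1/m-bound : ∀ p a b → suc p ℕ.* a ℕ.≤ (p ℕ.+ suc p) ℕ.* b →
              + a / 1 ≤ (+ 2 / 1 - + 1 / suc p) * (+ b / 1)
-- In unnormalised rationals the inequality is the hypothesis cross-multiplied; the other steps of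
-- the chain only undo normalisation.
2-1/m-bound p a b le = ℚ.toℚᵘ-cancel-≤ (begin
  toℚᵘ (+ a / 1)                                      ≃⟨ ℚ.toℚᵘ-fromℚᵘ (mkℚᵘ (+ a) 0) ⟩
  mkℚᵘ (+ a) 0                                        ≤⟨ *≤* cross ⟩
  (mkℚᵘ (+ 2) 0 ℚᵘ.- mkℚᵘ (+ 1) p) ℚᵘ.* mkℚᵘ (+ b) 0  ≃⟨ ℚᵘ.*-cong
      (ℚᵘ.+-cong ℚᵘ.≃-refl (ℚᵘ.-‿cong (ℚᵘ.≃-sym (ℚ.toℚᵘ-fromℚᵘ (mkℚᵘ (+ 1) p)))))
      (ℚᵘ.≃-sym (ℚ.toℚᵘ-fromℚᵘ (mkℚᵘ (+ b) 0))) ⟩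
  (toℚᵘ (+ 2 / 1) ℚᵘ.- toℚᵘ (+ 1 / suc p)) ℚᵘ.* toℚᵘ (+ b / 1)
    ≃⟨ ℚᵘ.*-cong {toℚᵘ (+ 2 / 1) ℚᵘ.- toℚᵘ (+ 1 / suc p)} (ℚᵘ.≃-sym (ℚᵘ.≃-trans
         (ℚ.toℚᵘ-homo-+ (+ 2 / 1) (ℚ.- (+ 1 / suc p)))
         (ℚᵘ.+-cong {toℚᵘ (+ 2 / 1)} ℚᵘ.≃-refl (ℚ.toℚᵘ-homo‿- (+ 1 / suc p))))) ℚᵘ.≃-refl ⟩
  toℚᵘ (+ 2 / 1 - + 1 / suc p) ℚᵘ.* toℚᵘ (+ b / 1)
    ≃⟨ ℚᵘ.≃-sym (ℚ.toℚᵘ-homo-* (+ 2 / 1 - + 1 / suc p) (+ b / 1)) ⟩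
  toℚᵘ ((+ 2 / 1 - + 1 / suc p) * (+ b / 1))          ∎)
  where
  open ℚᵘ.≤-Reasoning
  r = (mkℚᵘ (+ 2) 0 ℚᵘ.- mkℚᵘ (+ 1) p) ℚᵘ.* mkℚᵘ (+ b) 0
  -- The numerator of `2 - 1 / suc p` computes to `p + suc (p + 0)` and its denominator is `suc p`
  -- up to factors of one, which accounts for the rewriting.
  cross : + a ℤ.* ℚᵘ.↧ r ℤ.≤ ℚᵘ.↥ r ℤ.* + 1
  cross = subst₂ ℤ._≤_
    (trans (cong +_ (trans (ℕ.*-comm (suc p) a) (cong (a ℕ.*_) (sym (trans (ℕ.*-identityʳ _) (ℕ.*-identityˡ _))))))
      (ℤ.pos-* a _))
    (trans (cong +_ (cong (λ q → (p ℕ.+ suc q) ℕ.* b) (sym (ℕ.+-identityʳ p))))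
      (trans (ℤ.pos-* (p ℕ.+ suc (p ℕ.+ 0)) b) (sym (ℤ.*-identityʳ _))))
    (ℤ.+≤+ le)

theorem4 : (m : ℕ) .{{_ : NonZero m}} (𝓘 : Instance) →
    (∀ {t ε} {σ : Assignment m (size 𝓘)} → Run 𝓘 t ε σ → EF1 σ) ×
    (∀ {ε} {opt alg : Assignment m (size 𝓘)} →
    IsOptimal 𝓘 opt → Run 𝓘 (size 𝓘) ε alg →
    + ∣ scheduled opt ∣ / 1 ≤ (+ 2 / 1 - + 1 / m) * (+ ∣ scheduled alg ∣ / 1))
theorem4 zero {{m≢0}} 𝓘 = ⊥-elim-irr (NonZero.nonZero m≢0)
theorem4 (suc p) 𝓘 =
  (λ {_} {_} {σ} run → balanced⇒EF1 {σ = σ} (BalancedState.balanced (balanced-run 𝓘 run))) ,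
  λ {ε} {opt} {alg} (schedule , _) run → 2-1/m-bound p ∣ scheduled opt ∣ ∣ scheduled alg ∣
    (ℕ.≤-trans (ℕ.*-monoʳ-≤ (suc p) (greedy-optimal 𝓘 {τ = opt} schedule run)) (competitive 𝓘 run))
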